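{- Let $\mathbb{K}$ be a field and $f=a_0(x)+a_1(x)y+\cdots+a_n(x)y^n\in\mathbb{K}[x,y]$ with $n\geq 2$, $a_0,\ldots,a_n\in\mathbb{K}[x]$, $a_0a_n\neq 0$. Assume that $f$ has no nonconstant factor in $\mathbb{K}[x]$. If there exists an index $j$ with $0\leq j\leq n-1$ such that $$\deg a_j>\max_{i\neq j}\{\deg a_i+(j-i)\deg a_n\},$$ then $f$ is a product of at most $n-j$ irreducible polynomials over $\mathbb{K}[x]$. In particular, if $j=n-1$, then $f$ is irreducible over $\mathbb{K}[x]$.
   Context: $f$ is regarded as a polynomial in $y$ with coefficients in $\mathbb{K}[x]$; "a product of at most $k$ irreducible polynomials over $\mathbb{K}[x]$" means that in the factorization of $f$ into irreducible elements of $\mathbb{K}[x][y]$ the number of factors, counted with multiplicities, is at most $k$. -}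

module Defs where

open import Algebra.Bundles using (CommutativeRing)
open import Algebra.Bundles.Raw using (RawRing; RawSemiring)
import Algebra.Definitions.RawSemiring as SemiringDefinitions
open import Axiom.ExcludedMiddle using (ExcludedMiddle)
open import Data.Fin.Base using (Fin)
import Data.Fin.Properties as Fin
open import Data.Integer.Base as ℤ using (ℤ; +_)
import Data.Integer.Properties as ℤ
open import Data.List.Base as List using (List; []; _∷_; allFin; filter)
import Data.List.Extrema as Extrema
import Data.Maybe.Base as Maybe
open import Data.Nat.Base as ℕ using (ℕ; zero; suc)
open import Data.Product.Base using (∃-syntax; _×_)
open import Data.Vec.Functional using (Vector)
open import Level using (Level; _⊔_; Lift; lift; lower) renaming (suc to lsuc)
open import Relation.Binary.Bundles using (TotalOrder)
import Relation.Binary.Construct.Add.Infimum.NonStrict as NonStrict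
import Relation.Binary.Construct.Add.Infimum.Strict as Strict
open import Relation.Binary.Definitions using (Decidable)
open import Relation.Nullary.Construct.Add.Infimum using (_₋; ⊥₋; [_])
open import Relation.Nullary.Decidable using (yes; no; ¬?; map′)

-- The library's HeytingField is not used: it admits the zero ring.
record Field (c ℓ : Level) : Set (lsuc (c ⊔ ℓ)) where
  field
    commutativeRing : CommutativeRing c ℓ
  open CommutativeRing commutativeRing public
  field
    1≉0     : 1# ≉ 0#
    inverse : ∀ x → x ≉ 0# → ∃[ y ] x * y ≈ 1#

-- The list a₀ ∷ a₁ ∷ … ∷ aₙ ∷ [] stands for a₀ + a₁t + … + aₙtⁿ.  Trailing
-- zeros are allowed, so equality compares coefficients rather than lists.
module Polynomial {c ℓ} (R : RawRing c ℓ) where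
  open RawRing R

  Poly : Set c
  Poly = List Carrier

  coeff : Poly → ℕ → Carrier
  coeff []      _       = 0#
  coeff (a ∷ p) zero    = a
  coeff (a ∷ p) (suc i) = coeff p i

  infix 4 _≈ₚ_
  record _≈ₚ_ (p q : Poly) : Set ℓ where
    constructor mk≈
    field
      coeff-≈ : ∀ i → coeff p i ≈ coeff q i
  open _≈ₚ_ public

  infixl 6 _+ₚ_
  _+ₚ_ : Poly → Poly → Poly
  []      +ₚ q       = q
  (a ∷ p) +ₚ []      = a ∷ p
  (a ∷ p) +ₚ (b ∷ q) = a + b ∷ p +ₚ q

  -- (a + t p) q = a q + t (p q)
  infixl 7 _*ₚ_
  _*ₚ_ : Poly → Poly → Poly
  []      *ₚ q = []
  (a ∷ p) *ₚ q = List.map (a *_) q +ₚ (0# ∷ p *ₚ q)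

  const : Carrier → Poly
  const a = a ∷ []

  polynomialRing : RawRing c ℓ
  polynomialRing = record
    { Carrier = Poly ; _≈_ = _≈ₚ_ ; _+_ = _+ₚ_ ; _*_ = _*ₚ_
    ; -_ = List.map -_ ; 0# = [] ; 1# = const 1# }

  IsConstant : Poly → Set (c ⊔ ℓ)
  IsConstant p = ∃[ a ] p ≈ₚ const a

  -- The degree of the zero polynomial is ⊥₋, that is, -∞.
  module Degree (_≟_ : Decidable _≈_) where

    degree : Poly → ℕ ₋
    degree []      = ⊥₋
    degree (a ∷ p) with degree p | a ≟ 0#
    ... | [ d ] | _     = [ suc d ]
    ... | ⊥₋    | yes _ = ⊥₋
    ... | ⊥₋    | no  _ = [ 0 ]

ℤ₋ : Set
ℤ₋ = ℤ ₋

infixl 6 _+₋_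
_+₋_ : ℤ₋ → ℤ₋ → ℤ₋
_+₋_ = Maybe.zipWith ℤ._+_

-- Meaningful for finite d only: z ·₋ ⊥₋ is ⊥₋ by convention.
infixl 7 _·₋_
_·₋_ : ℤ → ℤ₋ → ℤ₋
z ·₋ d = Maybe.map (z ℤ.*_) d

infix 4 _>₋_
_>₋_ : ℤ₋ → ℤ₋ → Set
d >₋ e = e <₋ d
  where open Strict ℤ._<_ using (_<₋_)

ℤ₋-totalOrder : TotalOrder _ _ _
ℤ₋-totalOrder = record { isTotalOrder = ≤₋-isTotalOrder-≡ ℤ.≤-isTotalOrder }
  where open NonStrict ℤ._≤_ using (≤₋-isTotalOrder-≡)

-- The maximum of v i over all indices i ≠ j.
max-≢ : ∀ {m} → Fin m → (Fin m → ℤ₋) → ℤ₋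
max-≢ {m} j v =
  Extrema.max ℤ₋-totalOrder ⊥₋
    (List.map v (filter (λ i → ¬? (i Fin.≟ j)) (allFin m)))

module Factorisation {c ℓ} (R : RawSemiring c ℓ) where
  open RawSemiring R
  open SemiringDefinitions R using (Irreducible; product)

  record Factorization (f : Carrier) (m : ℕ) : Set (c ⊔ ℓ) where
    field
      factors     : Vector Carrier m
      irreducible : ∀ i → Irreducible (factors i)
      product≈    : product factors ≈ f

  -- A factorization into irreducibles exists, and every one has at most k
  -- factors, counted with multiplicity.
  ProductOfAtMost : ℕ → Carrier → Set (c ⊔ ℓ)
  ProductOfAtMost k f =
    (∃[ m ] m ℕ.≤ k × Factorization f m) ×
    (∀ m → Factorization f m → m ℕ.≤ k)

-- Excluded middle is assumed because over an arbitrary field neither degrees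
-- nor factorizations into irreducibles can be found constructively.
module Bivariate {c ℓ} (em : ExcludedMiddle (c ⊔ ℓ)) (K : Field c ℓ) where

  _≟_ : Decidable (Field._≈_ K)
  a ≟ b = map′ lower lift (em {Lift c (a ≈ b)})
    where open Field K using (_≈_)

  K[x] : RawRing c ℓ
  K[x] = Polynomial.polynomialRing (Field.rawRing K)

  K[x][y] : RawRing c ℓ
  K[x][y] = Polynomial.polynomialRing K[x]

  module K[x] where
    open RawRing K[x] public
    open Polynomial (Field.rawRing K) public using (IsConstant)
    open Polynomial.Degree (Field.rawRing K) _≟_ public using (degree)

    deg : Carrier → ℤ₋
    deg p = Maybe.map +_ (degree p)

  module K[x][y] where
    open RawRing K[x][y] public
    open Polynomial K[x] public using (const)
    open SemiringDefinitions rawSemiring public using (_∣_; Irreducible)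
    open Factorisation rawSemiring public

    -- a₀ + a₁y + … + aₙyⁿ
    fromCoeffs : ∀ {n} → (Fin (suc n) → K[x].Carrier) → Carrier
    fromCoeffs a = List.tabulate a

{-# OPTIONS --safe #-}

-- Give y the weight -s, where s = deg aₙ, so that b(x) yᵏ has weight deg b - k s.
-- The hypothesis says that among the terms of f the one of index j has strictly
-- the largest weight.  For any g let J(g) be the least index of a term of g of
-- maximal weight.  As for leading terms, J(g h) = J(g) + J(h), so that
-- deg_y g - J(g) is additive too; it equals n - j for f.  A non-unit divisor g
-- of f has deg_y g > 0, since f has no nonconstant factor in K[x], and then
-- deg_y g > J(g): if the leading coefficient b of g strictly dominated the
-- constant term, which is not zero, then deg b > s, but b divides aₙ.  So every
-- irreducible factor of f contributes at least 1 to n - j.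
module Submission where

open import Defs
open import Algebra.Bundles using (CommutativeRing; CommutativeSemiring)
import Algebra.Consequences.Setoid as Consequences
import Algebra.Construct.Pointwise as Pointwise
import Algebra.Morphism.RingMonomorphism as RingMonomorphism
open import Algebra.Morphism.Structures using (IsRingMonomorphism)
import Algebra.Properties.CommutativeSemigroup as CommutativeSemigroupProperties
import Algebra.Properties.CommutativeSemigroup.Divisibility as SemigroupDivisibility
import Algebra.Properties.Monoid.Sum as MonoidSum
import Algebra.Properties.Ring as RingProperties
import Algebra.Properties.Semiring.Divisibility as SemiringDivisibility
import Algebra.Properties.Semiring.Primality as Primality
open import Axiom.ExcludedMiddle using (ExcludedMiddle)
open import Data.Fin.Base using (Fin; zero; suc; toℕ; fromℕ; splitAt)
import Data.Fin.Properties as Fin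
open import Data.Integer.Base as ℤ using (+_; _-_)
import Data.Integer.Properties as ℤ
import Data.Integer.Tactic.RingSolver as ℤSolver
open import Data.List.Base using ([]; _∷_; length; map; tabulate)
import Data.List.Extrema as Extrema
open import Data.List.Membership.Propositional.Properties using (∈-allFin; ∈-filter⁺; ∈-map⁺)
import Data.List.Properties as List
import Data.List.Relation.Unary.All as All
open import Data.Maybe.Base as Maybe using (just; nothing)
open import Data.Nat.Base as ℕ using (ℕ; zero; suc; _≤_; _<_; _≥_; _∸_; z≤n; s≤s)
open import Data.Nat.Induction using (<-wellFounded)
import Data.Nat.Properties as ℕ
import Data.Nat.Tactic.RingSolver as ℕSolver
open import Data.Product.Base using (_×_; _,_; ∃-syntax; proj₁; proj₂)
open import Data.Sum.Base using (_⊎_; inj₁; inj₂; [_,_]′)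
open import Data.Sum.Properties using ([,]-map)
open import Data.Vec.Functional as Vector using (Vector; _++_; tail)
open import Data.Vec.Functional.Relation.Unary.All.Properties using (++⁺)
open import Function.Base using (_∘_)
open import Induction.WellFounded using (Acc; acc)
open import Level using (_⊔_; Lift; lift; lower)
import Relation.Binary.Construct.Add.Infimum.Strict as Strict
open import Relation.Binary.Definitions using (Decidable; tri<; tri≈; tri>)
open import Relation.Binary.PropositionalEquality.Core as ≡ using (_≡_; _≢_)
import Relation.Binary.Reasoning.Setoid as SetoidReasoning
open import Relation.Nullary.Construct.Add.Infimum using (_₋; ⊥₋; [_])
open import Relation.Nullary.Decidable.Core using (Dec; yes; no; decidable-stable; map′; ¬?)
open import Relation.Nullary.Negation.Core using (¬_; contradiction)
open import Relation.Unary using (Pred)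

open Strict ℤ._<_ using (<₋-transʳ; [<]-injective)

-- Formal power series as coefficient sequences with the Cauchy product.

module PowerSeries {c ℓ} (R : CommutativeRing c ℓ) where
  open CommutativeRing R
  open CommutativeSemigroupProperties +-commutativeSemigroup using (x∙yz≈y∙xz; interchange)
  open SetoidReasoning setoid
  private
    module Pointwiseᴿ = CommutativeRing (Pointwise.commutativeRing ℕ R)

  Series : Set c
  Series = ℕ → Carrier

  infix 4 _≋_
  _≋_ : Series → Series → Set ℓ
  _≋_ = Pointwiseᴿ._≈_

  infixl 6 _⊕_
  _⊕_ : Series → Series → Series
  _⊕_ = Pointwiseᴿ._+_

  infixl 7 _⊛_
  -- The recursion splits off the constant term of the left factor: with f = f₀ + t f′, the product
  -- is f₀ g + t (f′ g).
  _⊛_ : Series → Series → Series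
  (f ⊛ g) zero    = f 0 * g 0
  (f ⊛ g) (suc n) = f 0 * g (suc n) + (f ∘ suc ⊛ g) n

  one : Series
  one zero    = 1#
  one (suc _) = 0#

  ⊛-cong : ∀ {f f′ g g′} → f ≋ f′ → g ≋ g′ → f ⊛ g ≋ f′ ⊛ g′
  ⊛-cong f≋f′ g≋g′ zero    = *-cong (f≋f′ 0) (g≋g′ 0)
  ⊛-cong f≋f′ g≋g′ (suc n) =
    +-cong (*-cong (f≋f′ 0) (g≋g′ (suc n))) (⊛-cong (f≋f′ ∘ suc) g≋g′ n)

  -- The mirror image of the defining recursion, splitting off the constant term of the right
  -- factor; commutativity follows by comparing the two.
  ⊛-suc : ∀ f g n → (f ⊛ g) (suc n) ≈ f (suc n) * g 0 + (f ⊛ g ∘ suc) n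
  ⊛-suc f g zero    = +-comm _ _
  ⊛-suc f g (suc n) = trans (+-congˡ (⊛-suc (f ∘ suc) g n)) (x∙yz≈y∙xz _ _ _)

  ⊛-comm : ∀ f g → f ⊛ g ≋ g ⊛ f
  ⊛-comm f g zero    = *-comm (f 0) (g 0)
  ⊛-comm f g (suc n) =
    trans (+-cong (*-comm _ _) (⊛-comm (f ∘ suc) g n)) (sym (⊛-suc g f n))

  ⊛-zeroˡ : ∀ g → (λ _ → 0#) ⊛ g ≋ (λ _ → 0#)
  ⊛-zeroˡ g zero    = zeroˡ _
  ⊛-zeroˡ g (suc n) = trans (+-cong (zeroˡ _) (⊛-zeroˡ g n)) (+-identityʳ 0#)

  ⊛-identityˡ : ∀ g → one ⊛ g ≋ g
  ⊛-identityˡ g zero    = *-identityˡ _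
  ⊛-identityˡ g (suc n) =
    trans (+-cong (*-identityˡ _) (⊛-zeroˡ g n)) (+-identityʳ _)

  ⊛-distribʳ-⊕ : ∀ h f g → (f ⊕ g) ⊛ h ≋ (f ⊛ h) ⊕ (g ⊛ h)
  ⊛-distribʳ-⊕ h f g zero    = distribʳ _ _ _
  ⊛-distribʳ-⊕ h f g (suc n) =
    trans (+-cong (distribʳ _ _ _) (⊛-distribʳ-⊕ h (f ∘ suc) (g ∘ suc) n))
          (interchange _ _ _ _)

  ⊛-scaleˡ : ∀ a f g n → (((a *_) ∘ f) ⊛ g) n ≈ a * (f ⊛ g) n
  ⊛-scaleˡ a f g zero    = *-assoc _ _ _
  ⊛-scaleˡ a f g (suc n) =
    trans (+-cong (*-assoc _ _ _) (⊛-scaleˡ a (f ∘ suc) g n)) (sym (distribˡ _ _ _))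

  ⊛-assoc : ∀ f g h → (f ⊛ g) ⊛ h ≋ f ⊛ (g ⊛ h)
  ⊛-assoc f g h zero    = *-assoc _ _ _
  ⊛-assoc f g h (suc n) = begin
    -- The shifted series `(f ⊛ g) ∘ suc` unfolds to a sum of two series, so distributivity applies
    -- to it.
    f₀ * g 0 * h₊ + ((((f₀ *_) ∘ g ∘ suc) ⊕ (f ∘ suc ⊛ g)) ⊛ h) n
      ≈⟨ +-cong (*-assoc _ _ _) (⊛-distribʳ-⊕ h ((f₀ *_) ∘ g ∘ suc) (f ∘ suc ⊛ g) n) ⟩
    f₀ * (g 0 * h₊) + ((((f₀ *_) ∘ g ∘ suc) ⊛ h) n + ((f ∘ suc ⊛ g) ⊛ h) n)
      ≈⟨ +-congˡ (+-cong (⊛-scaleˡ f₀ (g ∘ suc) h n) (⊛-assoc (f ∘ suc) g h n)) ⟩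
    f₀ * (g 0 * h₊) + (f₀ * (g ∘ suc ⊛ h) n + (f ∘ suc ⊛ (g ⊛ h)) n)
      ≈⟨ +-assoc _ _ _ ⟨
    f₀ * (g 0 * h₊) + f₀ * (g ∘ suc ⊛ h) n + (f ∘ suc ⊛ (g ⊛ h)) n
      ≈⟨ +-congʳ (distribˡ _ _ _) ⟨
    f₀ * (g ⊛ h) (suc n) + (f ∘ suc ⊛ (g ⊛ h)) n ∎
    where
    f₀ = f 0
    h₊ = h (suc n)

  private
    module C = Consequences Pointwiseᴿ.setoid

  commutativeRing : CommutativeRing c ℓ
  commutativeRing = record
    { isCommutativeRing = record
      { isRing = record
        { +-isAbelianGroup = Pointwiseᴿ.+-isAbelianGroup
        ; *-cong     = ⊛-cong
        ; *-assoc    = ⊛-assoc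
        ; *-identity = C.comm∧idˡ⇒id ⊛-comm ⊛-identityˡ
        ; distrib    = C.comm∧distrʳ⇒distrˡ (Pointwiseᴿ.+-cong) ⊛-comm ⊛-distribʳ-⊕
                     , ⊛-distribʳ-⊕
        }
      ; *-comm = ⊛-comm
      }
    }

  module _ {p} {P : Pred Carrier p} (P-+ : ∀ {x y} → P x → P y → P (x + y)) where

    -- The coefficient of index `n` is a sum of the terms `f i * g j` with i + j = n, so closure
    -- under addition carries `P` from the terms to the coefficient.
    ⊛-closed : ∀ f g n → (∀ i j → i ℕ.+ j ≡ n → P (f i * g j)) → P ((f ⊛ g) n)
    ⊛-closed f g zero    P-* = P-* 0 0 ≡.refl
    ⊛-closed f g (suc n) P-* = P-+ (P-* 0 (suc n) ≡.refl)
      (⊛-closed (f ∘ suc) g n λ i j i+j≡n → P-* (suc i) j (≡.cong suc i+j≡n))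

    -- Pulls one term out of the convolution sum and keeps the others together in `r`. With `P`
    -- meaning "is zero" this computes leading coefficients; with `P` a degree bound it computes the
    -- dominant term.
    ⊛-isolate : P 0# → ∀ f g i j →
                (∀ k l → k ℕ.+ l ≡ i ℕ.+ j → k ≢ i → P (f k * g l)) →
                ∃[ r ] P r × (f ⊛ g) (i ℕ.+ j) ≈ f i * g j + r
    ⊛-isolate P-0 f g zero    zero    P-* = 0# , P-0 , sym (+-identityʳ _)
    ⊛-isolate P-0 f g zero    (suc j) P-* =
      _ , ⊛-closed (f ∘ suc) g j (λ k l k+l≡j → P-* (suc k) l (≡.cong suc k+l≡j) λ ())
        , refl
    ⊛-isolate P-0 f g (suc i) j       P-* =
      let r , P-r , eq = ⊛-isolate P-0 (f ∘ suc) g i j λ k l k+l≡i+j k≢i →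
            P-* (suc k) l (≡.cong suc k+l≡i+j) (k≢i ∘ ℕ.suc-injective)
      in  _ , P-+ (P-* 0 (suc (i ℕ.+ j)) ≡.refl λ ()) P-r
        , trans (+-congˡ eq) (x∙yz≈y∙xz _ _ _)

-- Polynomials as a subring of the power series.

module PolynomialRing {c ℓ} (R : CommutativeRing c ℓ) where
  open CommutativeRing R
  open Polynomial rawRing public
  open PowerSeries R using (_≋_; _⊛_; one; ⊛-zeroˡ)
  private
    module Series = CommutativeRing (PowerSeries.commutativeRing R)

  coeff-+ : ∀ p q i → coeff (p +ₚ q) i ≈ coeff p i + coeff q i
  coeff-+ []      q       i       = sym (+-identityˡ _)
  coeff-+ (a ∷ p) []      i       = sym (+-identityʳ _)
  coeff-+ (a ∷ p) (b ∷ q) zero    = refl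
  coeff-+ (a ∷ p) (b ∷ q) (suc i) = coeff-+ p q i

  coeff-map : ∀ {φ} → φ 0# ≈ 0# → ∀ p i → coeff (map φ p) i ≈ φ (coeff p i)
  coeff-map φ0≈0 []      i       = sym φ0≈0
  coeff-map φ0≈0 (a ∷ p) zero    = refl
  coeff-map φ0≈0 (a ∷ p) (suc i) = coeff-map φ0≈0 p i

  coeff-* : ∀ p q → coeff (p *ₚ q) ≋ coeff p ⊛ coeff q
  coeff-* []      q i       = sym (⊛-zeroˡ (coeff q) i)
  coeff-* (a ∷ p) q zero    = trans (coeff-+ (map (a *_) q) _ 0)
    (trans (+-identityʳ _) (coeff-map (zeroʳ a) q 0))
  coeff-* (a ∷ p) q (suc i) = trans (coeff-+ (map (a *_) q) _ (suc i))
    (+-cong (coeff-map (zeroʳ a) q (suc i)) (coeff-* p q i))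

  coeff-1 : coeff (const 1#) ≋ one
  coeff-1 zero    = refl
  coeff-1 (suc _) = refl

  -- Equality of lists is equality of coefficients, so `coeff` is injective and the ring laws proved
  -- for series pull back to lists.
  coeff-isRingMonomorphism : IsRingMonomorphism polynomialRing Series.rawRing coeff
  coeff-isRingMonomorphism = record
    { isRingHomomorphism = record
      { isSemiringHomomorphism = record
        { isNearSemiringHomomorphism = record
          { +-isMonoidHomomorphism = record
            { isMagmaHomomorphism = record
              { isRelHomomorphism = record { cong = coeff-≈ }
              ; homo              = coeff-+
              }
            ; ε-homo = λ _ → refl
            }
          ; *-homo = coeff-*
          }
        ; 1#-homo = coeff-1
        }
      ; -‿homo = coeff-map (RingProperties.-0#≈0# ring)
      }
    ; injective = mk≈
    }

  commutativeRing : CommutativeRing c ℓ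
  commutativeRing = record
    { isCommutativeRing = RingMonomorphism.isCommutativeRing
        coeff-isRingMonomorphism Series.isCommutativeRing
    }

-- Pairs of indices with equal sum, least witnesses, absence of zero divisors.

+-≡-split : ∀ {i j k l} → k ℕ.+ l ≡ i ℕ.+ j → k ≢ i → k < i ⊎ l < j
+-≡-split {i} {j} {k} {l} k+l≡i+j k≢i with ℕ.<-cmp k i
... | tri< k<i _ _ = inj₁ k<i
... | tri≈ _ k≡i _ = contradiction k≡i k≢i
... | tri> _ _ i<k = inj₂ (ℕ.≰⇒> λ j≤l →
  ℕ.<⇒≢ (ℕ.+-mono-<-≤ i<k j≤l) (≡.sym k+l≡i+j))

least : ∀ {p} {P : ℕ → Set p} → (∀ n → Dec (P n)) → ∀ n → P n →
        ∃[ m ] P m × (∀ k → k < m → ¬ P k)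
least P? zero    P0 = 0 , P0 , λ _ ()
least P? (suc n) Pn with P? 0
... | yes P0 = 0 , P0 , λ _ ()
... | no ¬P0 =
  let m , Pm , ¬P = least (P? ∘ suc) n Pn
  in  suc m , Pm , λ where
        zero    _         → ¬P0
        (suc k) (s≤s k<m) → ¬P k k<m

NoZeroDivisors : ∀ {c ℓ} → CommutativeRing c ℓ → Set _
NoZeroDivisors R = ∀ {x y} → x ≉ 0# → y ≉ 0# → x * y ≉ 0#
  where open CommutativeRing R

-- Degree bounds and exact degrees.

module DegreeProperties {c ℓ} (R : CommutativeRing c ℓ) where
  open CommutativeRing R
  open PolynomialRing R
  open PowerSeries R using (⊛-closed; ⊛-isolate)

  -- The bound is strict, so that `DegreeBelow 0` describes the zero polynomial and natural numbers
  -- suffice without -∞.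
  record DegreeBelow (d : ℕ) (p : Poly) : Set ℓ where
    constructor below
    field
      vanishes : ∀ i → d ≤ i → coeff p i ≈ 0#
  open DegreeBelow public

  below-resp-≈ : ∀ {d p q} → p ≈ₚ q → DegreeBelow d p → DegreeBelow d q
  below-resp-≈ p≈q p<d .vanishes i d≤i = trans (sym (coeff-≈ p≈q i)) (vanishes p<d i d≤i)

  below-mono : ∀ {d e p} → d ≤ e → DegreeBelow d p → DegreeBelow e p
  below-mono d≤e p<d .vanishes i e≤i = vanishes p<d i (ℕ.≤-trans d≤e e≤i)

  below-zero : ∀ {d} → DegreeBelow d []
  below-zero .vanishes _ _ = refl

  below-0⇒≈0 : ∀ {p} → DegreeBelow 0 p → p ≈ₚ []
  below-0⇒≈0 p<0 .coeff-≈ i = vanishes p<0 i z≤n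

  below-length : ∀ p → DegreeBelow (length p) p
  below-length p .vanishes = go p
    where
    go : ∀ p i → length p ≤ i → coeff p i ≈ 0#
    go []      i       _           = refl
    go (_ ∷ p) (suc i) (s≤s len≤i) = go p i len≤i

  below-+ : ∀ {d p q} → DegreeBelow d p → DegreeBelow d q → DegreeBelow d (p +ₚ q)
  below-+ {p = p} {q} p<d q<d .vanishes i d≤i = trans (coeff-+ p q i)
    (trans (+-cong (vanishes p<d i d≤i) (vanishes q<d i d≤i)) (+-identityʳ 0#))

  private
    0-+-closed : ∀ {x y} → x ≈ 0# → y ≈ 0# → x + y ≈ 0#
    0-+-closed x≈0 y≈0 = trans (+-cong x≈0 y≈0) (+-identityʳ 0#)

  -- In a coefficient of index at least d + e every term has i > d or j ≥ e. The asymmetric form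
  -- serves two purposes: a strict bound on one factor is kept, and for `e` a successor both bounds
  -- are non-strict.
  below-* : ∀ {d e p q} → DegreeBelow (suc d) p → DegreeBelow e q →
            DegreeBelow (d ℕ.+ e) (p *ₚ q)
  below-* {d} {e} {p} {q} p≤d q<e .vanishes n d+e≤n =
    trans (coeff-* p q n) (⊛-closed {P = _≈ 0#} 0-+-closed (coeff p) (coeff q) n vanish)
    where
    vanish : ∀ i j → i ℕ.+ j ≡ n → coeff p i * coeff q j ≈ 0#
    vanish i j i+j≡n with i ℕ.≤? d
    ... | no  i≰d = trans (*-congʳ (vanishes p≤d i (ℕ.≰⇒> i≰d))) (zeroˡ _)
    ... | yes i≤d = trans (*-congˡ (vanishes q<e j e≤j)) (zeroʳ _)
      where
      e≤j : e ≤ j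
      e≤j = ℕ.+-cancelˡ-≤ d e j (ℕ.≤-trans d+e≤n
        (ℕ.≤-trans (ℕ.≤-reflexive (≡.sym i+j≡n)) (ℕ.+-monoˡ-≤ j i≤d)))

  coeff-*-top : ∀ {d e p q} → DegreeBelow (suc d) p → DegreeBelow (suc e) q →
                coeff (p *ₚ q) (d ℕ.+ e) ≈ coeff p d * coeff q e
  coeff-*-top {d} {e} {p} {q} p≤d q≤e =
    let r , r≈0 , eq = ⊛-isolate {P = _≈ 0#} 0-+-closed refl (coeff p) (coeff q) d e vanish
    in  trans (coeff-* p q (d ℕ.+ e)) (trans eq (trans (+-congˡ r≈0) (+-identityʳ _)))
    where
    vanish : ∀ k l → k ℕ.+ l ≡ d ℕ.+ e → k ≢ d → coeff p k * coeff q l ≈ 0#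
    -- The split is used with the two pairs exchanged, so that one of the indices exceeds its degree
    -- bound.
    vanish k l k+l≡d+e k≢d with +-≡-split (≡.sym k+l≡d+e) (k≢d ∘ ≡.sym)
    ... | inj₁ d<k = trans (*-congʳ (vanishes p≤d k d<k)) (zeroˡ _)
    ... | inj₂ e<l = trans (*-congˡ (vanishes q≤e l e<l)) (zeroʳ _)

  record HasDegree (p : Poly) (d : ℕ) : Set ℓ where
    field
      bounded : DegreeBelow (suc d) p
      leading : coeff p d ≉ 0#

  degree-resp-≈ : ∀ {p q d} → p ≈ₚ q → HasDegree p d → HasDegree q d
  degree-resp-≈ p≈q pᵈ = record
    { bounded = below-resp-≈ p≈q bounded
    ; leading = leading ∘ trans (coeff-≈ p≈q _)
    } where open HasDegree pᵈ

  degree<bound : ∀ {p d e} → HasDegree p d → DegreeBelow e p → d < e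
  degree<bound pᵈ p<e = ℕ.≰⇒> (HasDegree.leading pᵈ ∘ vanishes p<e _)

  degree-unique : ∀ {p d e} → HasDegree p d → HasDegree p e → d ≡ e
  degree-unique pᵈ pᵉ = ℕ.≤-antisym
    (ℕ.s≤s⁻¹ (degree<bound pᵈ (HasDegree.bounded pᵉ)))
    (ℕ.s≤s⁻¹ (degree<bound pᵉ (HasDegree.bounded pᵈ)))

  degree-* : NoZeroDivisors R → ∀ {p q d e} →
             HasDegree p d → HasDegree q e → HasDegree (p *ₚ q) (d ℕ.+ e)
  degree-* noZeroDivisors {p} {q} {d} {e} pᵈ qᵉ = record
    { bounded = ≡.subst (λ n → DegreeBelow n (p *ₚ q)) (ℕ.+-suc d e) (below-* P.bounded Q.bounded)
    ; leading = noZeroDivisors P.leading Q.leading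
                ∘ trans (sym (coeff-*-top P.bounded Q.bounded))
    }
    where
    module P = HasDegree pᵈ
    module Q = HasDegree qᵉ

  module _ (_≟_ : Decidable _≈_) where
    open Degree _≟_

    degree-≡⊥ : ∀ p → degree p ≡ ⊥₋ → p ≈ₚ []
    degree-≡⊥ []      _  = mk≈ λ _ → refl
    degree-≡⊥ (a ∷ p) eq with degree p | degree-≡⊥ p | a ≟ 0#
    degree-≡⊥ (a ∷ p) () | [ _ ] | _   | _
    degree-≡⊥ (a ∷ p) () | ⊥₋    | _   | no _
    degree-≡⊥ (a ∷ p) eq | ⊥₋    | p≈0 | yes a≈0 = mk≈ λ where
      zero    → a≈0
      (suc i) → coeff-≈ (p≈0 ≡.refl) i

    degree-≡[] : ∀ p {d} → degree p ≡ [ d ] → HasDegree p d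
    degree-≡[] (a ∷ p) eq with degree p | degree-≡⊥ p | degree-≡[] p | a ≟ 0#
    degree-≡[] (a ∷ p) ≡.refl | [ d ] | _ | pᵈ | _ = record
      { bounded = below λ where (suc i) (s≤s d≤i) → vanishes (HasDegree.bounded (pᵈ ≡.refl)) i d≤i
      ; leading = HasDegree.leading (pᵈ ≡.refl)
      }
    degree-≡[] (a ∷ p) ≡.refl | ⊥₋ | p≈0 | _ | no a≉0 = record
      { bounded = below λ where (suc i) _ → coeff-≈ (p≈0 ≡.refl) i
      ; leading = a≉0
      }

    degree-exists : ∀ {p} → ¬ p ≈ₚ [] → ∃[ d ] HasDegree p d
    degree-exists {p} p≉0 with degree p in eq
    ... | ⊥₋    = contradiction (degree-≡⊥ p eq) p≉0
    ... | [ d ] = d , degree-≡[] p eq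

    -- The product of the leading coefficients is a nonzero coefficient of the product.
    noZeroDivisors-poly : NoZeroDivisors R → NoZeroDivisors commutativeRing
    noZeroDivisors-poly noZeroDivisors p≉0 q≉0 pq≈0 =
      let _ , pᵈ = degree-exists p≉0
          _ , qᵉ = degree-exists q≉0
      in  HasDegree.leading (degree-* noZeroDivisors pᵈ qᵉ) (coeff-≈ pq≈0 _)

-- Weights of the terms of a bivariate polynomial and the first term of maximal weight.

module Dominance {c ℓ} (R : CommutativeRing c ℓ) (noZeroDivisors : NoZeroDivisors R)
                 (dec : (P : Set ℓ) → Dec P) (s : ℕ) where
  module R[x]    = PolynomialRing R
  module R[x][y] = PolynomialRing R[x].commutativeRing
  private
    module R[x]′ = CommutativeRing R[x].commutativeRing
  open CommutativeRing R
  open DegreeProperties R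
  open PowerSeries R[x].commutativeRing using (⊛-closed; ⊛-isolate)

  -- In g = Σ bₖ yᵏ the weight deg bₖ - k s is maximal, equal to w, at k = i, and
  -- i is the least such index.  If b₀ ≉ 0, then w ≥ deg b₀ is a natural number.
  record Dominant (g : R[x][y].Poly) (i w : ℕ) : Set ℓ where
    field
      strict   : ∀ k → k < i → DegreeBelow (w ℕ.+ k ℕ.* s) (R[x][y].coeff g k)
      bounded  : ∀ k → DegreeBelow (suc (w ℕ.+ k ℕ.* s)) (R[x][y].coeff g k)
      attained : R[x].coeff (R[x][y].coeff g i) (w ℕ.+ i ℕ.* s) ≉ 0#

    hasDegree : HasDegree (R[x][y].coeff g i) (w ℕ.+ i ℕ.* s)
    hasDegree = record { bounded = bounded i ; leading = attained }

  dominant-resp-≈ : ∀ {g h i w} → g R[x][y].≈ₚ h → Dominant g i w → Dominant h i w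
  dominant-resp-≈ g≈h gᵈ = record
    { strict   = λ k k<i → below-resp-≈ (R[x][y].coeff-≈ g≈h k) (strict k k<i)
    ; bounded  = λ k → below-resp-≈ (R[x][y].coeff-≈ g≈h k) (bounded k)
    ; attained = attained ∘ trans (R[x].coeff-≈ (R[x][y].coeff-≈ g≈h _) _)
    } where open Dominant gᵈ

  -- Each weight is attained, hence at most the other. If j < i, then the term of index j would
  -- attain `w` and yet have weight below `v`, so w < v, a contradiction.
  dominant-unique : ∀ {g i j v w} → Dominant g i v → Dominant g j w → i ≡ j
  dominant-unique {g} gⁱ gʲ =
    ℕ.≤-antisym (ℕ.≮⇒≥ (index gⁱ gʲ)) (ℕ.≮⇒≥ (index gʲ gⁱ))
    where
    weight≤ : ∀ {i j v w} → Dominant g i v → Dominant g j w → v ≤ w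
    weight≤ {i} gⁱ gʲ = ℕ.+-cancelʳ-≤ (i ℕ.* s) _ _
      (ℕ.s≤s⁻¹ (degree<bound (Dominant.hasDegree gⁱ) (Dominant.bounded gʲ i)))

    index : ∀ {i j v w} → Dominant g i v → Dominant g j w → ¬ j < i
    index {i} {j} gⁱ gʲ j<i = ℕ.<⇒≱
      (ℕ.+-cancelʳ-< (j ℕ.* s) _ _
        (degree<bound (Dominant.hasDegree gʲ) (Dominant.strict gⁱ j j<i)))
      (weight≤ gⁱ gʲ)

  private
    weight-+ : ∀ v w i j → (v ℕ.+ i ℕ.* s) ℕ.+ (w ℕ.+ j ℕ.* s) ≡
                           (v ℕ.+ w) ℕ.+ (i ℕ.+ j) ℕ.* s
    weight-+ v w i j = lemma v w i j s
      where
      lemma : ∀ v w i j s → (v ℕ.+ i ℕ.* s) ℕ.+ (w ℕ.+ j ℕ.* s) ≡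
                            (v ℕ.+ w) ℕ.+ (i ℕ.+ j) ℕ.* s
      lemma = ℕSolver.solve-∀

  module _ {g h i j v w} (gᵈ : Dominant g i v) (hᵈ : Dominant h j w) where
    private
      module G = Dominant gᵈ
      module H = Dominant hᵈ

      term : ℕ → ℕ → R[x].Poly
      term k l = R[x][y].coeff g k R[x].*ₚ R[x][y].coeff h l

      term-bounded : ∀ k l → DegreeBelow (suc (v ℕ.+ w ℕ.+ (k ℕ.+ l) ℕ.* s)) (term k l)
      term-bounded k l = ≡.subst (λ n → DegreeBelow n (term k l))
        (≡.trans (ℕ.+-suc _ _) (≡.cong suc (weight-+ v w k l)))
        (below-* (G.bounded k) (H.bounded l))

      term-strictʳ : ∀ k l → l < j → DegreeBelow (v ℕ.+ w ℕ.+ (k ℕ.+ l) ℕ.* s) (term k l)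
      term-strictʳ k l l<j = ≡.subst (λ n → DegreeBelow n (term k l))
        (weight-+ v w k l) (below-* (G.bounded k) (H.strict l l<j))

      term-strictˡ : ∀ k l → k < i → DegreeBelow (v ℕ.+ w ℕ.+ (k ℕ.+ l) ℕ.* s) (term k l)
      -- `below-*` takes its strict bound on the right factor, so the two factors are exchanged
      -- first.
      term-strictˡ k l k<i = below-resp-≈ 
        (R[x]′.*-comm (R[x][y].coeff h l) (R[x][y].coeff g k))
        (≡.subst (λ n → DegreeBelow n (R[x][y].coeff h l R[x].*ₚ R[x][y].coeff g k))
        (≡.trans (ℕ.+-comm (w ℕ.+ l ℕ.* s) _) (weight-+ v w k l))
        (below-* (H.bounded l) (G.strict k k<i)))

      term-strict : ∀ k l → k < i ⊎ l < j →
                    DegreeBelow (v ℕ.+ w ℕ.+ (k ℕ.+ l) ℕ.* s) (term k l)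
      term-strict k l = [ term-strictˡ k l , term-strictʳ k l ]′

      bounded-* : ∀ {d} n → (∀ k l → k ℕ.+ l ≡ n → DegreeBelow d (term k l)) →
                  DegreeBelow d (R[x][y].coeff (g R[x][y].*ₚ h) n)
      bounded-* n bound = below-resp-≈ (R[x]′.sym (R[x][y].coeff-* g h n))
        (⊛-closed {P = DegreeBelow _} below-+ (R[x][y].coeff g) (R[x][y].coeff h) n bound)

    -- If k + l < i + j, then k < i or l < j, so the term is strictly lighter than v + w. At index i
    -- + j only the pair (i, j) reaches that weight, and its top coefficient is a product of two
    -- nonzero elements of `R`.
    dominant-* : Dominant (g R[x][y].*ₚ h) (i ℕ.+ j) (v ℕ.+ w)
    dominant-* = record
      { strict   = λ n n<i+j → bounded-* n λ where
          k l ≡.refl → term-strict k l (split k l n<i+j)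
      ; bounded  = λ n → bounded-* n λ where
          k l ≡.refl → term-bounded k l
      ; attained = λ top≈0 → noZeroDivisors G.attained H.attained (trans (sym top) top≈0)
      }
      where
      split : ∀ k l → k ℕ.+ l < i ℕ.+ j → k < i ⊎ l < j
      split k l k+l<i+j with k ℕ.<? i
      ... | yes k<i = inj₁ k<i
      ... | no  k≮i = inj₂ (ℕ.≰⇒> λ j≤l →
        ℕ.<⇒≱ k+l<i+j (ℕ.+-mono-≤ (ℕ.≮⇒≥ k≮i) j≤l))

      W = v ℕ.+ w ℕ.+ (i ℕ.+ j) ℕ.* s

      off-diagonal : ∀ k l → k ℕ.+ l ≡ i ℕ.+ j → k ≢ i → DegreeBelow W (term k l)
      off-diagonal k l k+l≡i+j k≢i =
        ≡.subst (λ n → DegreeBelow (v ℕ.+ w ℕ.+ n ℕ.* s) (term k l)) k+l≡i+j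
          (term-strict k l (+-≡-split k+l≡i+j k≢i))

      top : R[x].coeff (R[x][y].coeff (g R[x][y].*ₚ h) (i ℕ.+ j)) W ≈
            R[x].coeff (R[x][y].coeff g i) (v ℕ.+ i ℕ.* s) *
            R[x].coeff (R[x][y].coeff h j) (w ℕ.+ j ℕ.* s)
      top =
        -- All terms off the pair (i, j) have degree below `W`, so their sum `r` contributes nothing
        -- to the coefficient at `W`.
        let r , r< , eq = ⊛-isolate {P = DegreeBelow W} below-+ below-zero
                            (R[x][y].coeff g) (R[x][y].coeff h) i j off-diagonal
        in  trans (R[x].coeff-≈ (R[x]′.trans (R[x][y].coeff-* g h (i ℕ.+ j)) eq) W)
              (trans (R[x].coeff-+ (term i j) r W)
              (trans (+-congˡ (vanishes r< W ℕ.≤-refl))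
              (trans (+-identityʳ _)
              (trans (reflexive (≡.cong (R[x].coeff (term i j)) (≡.sym (weight-+ v w i j))))
                     (coeff-*-top (G.bounded i) (H.bounded j))))))

  -- All weights lie strictly below `w`; the least such `w` is therefore one more than the maximal
  -- weight, if that weight is a natural number.
  Bounded : R[x][y].Poly → ℕ → Set ℓ
  Bounded g w = ∀ k → DegreeBelow (w ℕ.+ k ℕ.* s) (R[x][y].coeff g k)

  bound-exists : ∀ g → ∃[ w ] Bounded g w
  bound-exists []      = 0 , λ _ → below-zero
  bound-exists (b ∷ g) =
    let w , bound = bound-exists g
    in  length b ℕ.⊔ w , λ where
          zero    → below-mono (ℕ.≤-trans (ℕ.m≤m⊔n (length b) w) (ℕ.m≤m+n _ 0)) (below-length b)
          (suc k) → below-mono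
            (ℕ.+-mono-≤ (ℕ.m≤n⊔m (length b) w) (ℕ.m≤n+m (k ℕ.* s) s)) (bound k)

  -- The least strict bound on the weights is not 0, because the constant term is nonzero and has
  -- weight at least 0. So it is `suc w`; by minimality `w` fails at some index, and the first such
  -- index is dominant.
  dominant-exists : ∀ {g} → ¬ R[x][y].coeff g 0 R[x].≈ₚ [] → ∃[ i ] ∃[ w ] Dominant g i w
  dominant-exists {g} b₀≉0 with
    (let v , bound = bound-exists g in least (λ w → dec (Bounded g w)) v bound)
  ... | zero  , bound , _       = contradiction (below-0⇒≈0 (bound 0)) b₀≉0
  ... | suc w , bound , minimal =
    let k , ¬bound = decidable-stable (dec (∃[ k ] ¬ Below k)) λ ¬∃ →
          minimal w ℕ.≤-refl λ k → decidable-stable (dec (Below k)) λ ¬b → ¬∃ (k , ¬b)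
        i , ¬boundᵢ , boundₖ = least (λ k → ¬? (dec (Below k))) k ¬bound
    in  i , w , record
          { strict   = λ k k<i → decidable-stable (dec (Below k)) (boundₖ k k<i)
          ; bounded  = bound
          -- If this coefficient vanished, the bound `suc w` at index `i` would improve to `w`,
          -- contrary to the choice of `i`.
          ; attained = λ top≈0 → ¬boundᵢ (below λ n w≤n →
              [ (λ w<n → vanishes (bound i) n w<n) , (λ where ≡.refl → top≈0) ]′
                (ℕ.m≤n⇒m<n∨m≡n w≤n))
          }
    where
    Below : ℕ → Set ℓ
    Below k = DegreeBelow (w ℕ.+ k ℕ.* s) (R[x][y].coeff g k)

-- Bounding the number of irreducible factors by an additive size.

module FactorCount {c ℓ} (S : CommutativeSemiring c ℓ) where
  open CommutativeSemiring S hiding (zero)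
  open SemiringDivisibility semiring using (_∣_; _∤_; _,_; ∣-refl; ∣-trans)
  open SemigroupDivisibility *-commutativeSemigroup using (xy≈z⇒x∣z; xy≈z⇒y∣z)
  open Primality semiring using (Irreducible; mkIrred)
  open Irreducible using (p∤1)
  open Factorisation rawSemiring
  open Factorization
  open MonoidSum *-monoid using () renaming (sum to product; sum-cong-≗ to product-cong-≗)

  -- An abstract length function on the divisors of `f`. It is a relation because a size is required
  -- to exist for divisors of `f` only.
  record IsSizeOfDivisors {s} (f : Carrier) (HasSize : Carrier → ℕ → Set s) : Set (c ⊔ ℓ ⊔ s) where
    field
      resp-≈   : ∀ {g h k} → g ≈ h → HasSize g k → HasSize h k
      unique   : ∀ {g k l} → HasSize g k → HasSize g l → k ≡ l
      exists   : ∀ {g} → g ∣ f → ∃[ k ] HasSize g k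
      homo     : ∀ {g h k l} → HasSize g k → HasSize h l → HasSize (g * h) (k ℕ.+ l)
      positive : ∀ {g k} → g ∣ f → g ∤ 1# → HasSize g k → 0 < k

  product-++ : ∀ {m n} (xs : Vector Carrier m) (ys : Vector Carrier n) →
               product (xs ++ ys) ≈ product xs * product ys
  product-++ {zero}  xs ys = sym (*-identityˡ _)
  product-++ {suc m} xs ys = trans
    (*-congˡ (trans (reflexive (product-cong-≗ (λ i → [,]-map (splitAt m i))))
                    (product-++ (tail xs) ys)))
    (sym (*-assoc _ _ _))

  module _ (em : ExcludedMiddle (c ⊔ ℓ))
           {s} {f} {HasSize : Carrier → ℕ → Set s} (isSize : IsSizeOfDivisors f HasSize) where
    open IsSizeOfDivisors isSize

    private
      split-size : ∀ {g x y k} → g ∣ f → x * y ≈ g → HasSize g k →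
                   ∃[ l ] ∃[ m ] HasSize x l × HasSize y m × l ℕ.+ m ≡ k
      split-size g∣f xy≈g gᵏ =
        let l , xˡ = exists (∣-trans (xy≈z⇒x∣z _ _ xy≈g) g∣f)
            m , yᵐ = exists (∣-trans (xy≈z⇒y∣z _ _ xy≈g) g∣f)
        in  l , m , xˡ , yᵐ , unique (resp-≈ xy≈g (homo xˡ yᵐ)) gᵏ

    -- If y x ≈ 1, then f ≈ (f y) x, so size f = size f + size y + size x.
    unit-size : ∀ {x k} → x ∣ 1# → HasSize x k → k ≡ 0
    unit-size {x} (y , yx≈1) xᵏ =
      let n , fⁿ = exists ∣-refl
          f≈fy*x = trans (*-assoc f y x) (trans (*-congˡ yx≈1) (*-identityʳ f))
          l , m , fyˡ , xᵐ , l+m≡n = split-size ∣-refl f≈fy*x fⁿ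
          l₁ , l₂ , fˡ₁ , yˡ₂ , l₁+l₂≡l = split-size (xy≈z⇒x∣z _ _ f≈fy*x) refl fyˡ
          n≡l₁ = unique fⁿ fˡ₁
          l₂+m≡0 = ℕ.+-cancelˡ-≡ n (l₂ ℕ.+ m) 0 (≡.trans (≡.sym (ℕ.+-assoc n l₂ m))
            (≡.trans (≡.cong (ℕ._+ m) (≡.trans (≡.cong (ℕ._+ l₂) n≡l₁) l₁+l₂≡l))
            (≡.trans l+m≡n (≡.sym (ℕ.+-identityʳ n)))))
      in  ≡.trans (unique xᵏ xᵐ) (ℕ.m+n≡0⇒n≡0 l₂ l₂+m≡0)

    -- Sizes add up along the product, and each non-unit factor contributes at least 1.
    length≤size : ∀ {m} (xs : Vector Carrier m) → (∀ i → xs i ∤ 1#) →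
                  ∀ {g k} → g ∣ f → product xs ≈ g → HasSize g k → m ≤ k
    length≤size {zero}  xs _    _   _    _  = z≤n
    length≤size {suc m} xs xs∤1 g∣f ∏≈g gᵏ =
      let _ , _ , xˡ , ysᵐ , l+m≡k = split-size g∣f ∏≈g gᵏ
      in  ≡.subst (suc m ≤_) l+m≡k (ℕ.+-mono-≤
            (positive (∣-trans (xy≈z⇒x∣z _ _ ∏≈g) g∣f) (xs∤1 zero) xˡ)
            (length≤size (tail xs) (xs∤1 ∘ suc) (∣-trans (xy≈z⇒y∣z _ _ ∏≈g) g∣f) refl ysᵐ))

    -- Induction on the size: in a splitting into two non-units both sizes are positive, so each is
    -- smaller than their sum. Excluded middle decides whether such a splitting exists; if none
    -- does, `g` is irreducible.
    factorization-exists : ∀ {g k} → Acc _<_ k → g ∣ f → g ∤ 1# → HasSize g k →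
                           ∃[ m ] m ≤ k × Factorization g m
    factorization-exists {g} (acc rec) g∣f g∤1 gᵏ
      with em {∃[ x ] ∃[ y ] x * y ≈ g × x ∤ 1# × y ∤ 1#}
    ... | no ¬split = 1 , positive g∣f g∤1 gᵏ , record
      { factors     = λ _ → g
      ; irreducible = λ _ → mkIrred g∤1 split
      ; product≈    = *-identityʳ g
      }
      where
      split : ∀ {x y} → g ≈ x * y → x ∣ 1# ⊎ y ∣ 1#
      split {x} {y} g≈xy with em {x ∣ 1#} | em {y ∣ 1#}
      ... | yes x∣1 | _       = inj₁ x∣1
      ... | no _    | yes y∣1 = inj₂ y∣1
      ... | no x∤1  | no y∤1  = contradiction (x , y , sym g≈xy , x∤1 , y∤1) ¬split
    ... | yes (x , y , xy≈g , x∤1 , y∤1) with split-size g∣f xy≈g gᵏ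
    ...   | l , m , xˡ , yᵐ , ≡.refl =
      let x∣f = ∣-trans (xy≈z⇒x∣z x y xy≈g) g∣f
          y∣f = ∣-trans (xy≈z⇒y∣z x y xy≈g) g∣f
          m₁ , m₁≤l , F₁ = factorization-exists
            (rec (ℕ.m<m+n l (positive y∣f y∤1 yᵐ))) x∣f x∤1 xˡ
          m₂ , m₂≤m , F₂ = factorization-exists
            (rec (ℕ.m<n+m m (positive x∣f x∤1 xˡ))) y∣f y∤1 yᵐ
      in  m₁ ℕ.+ m₂ , ℕ.+-mono-≤ m₁≤l m₂≤m , record
            { factors     = factors F₁ ++ factors F₂
            ; irreducible = ++⁺ Irreducible {factors F₁} (irreducible F₁) (irreducible F₂)
            ; product≈    = trans (product-++ (factors F₁) (factors F₂))
                (trans (*-cong (product≈ F₁) (product≈ F₂)) xy≈g)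
            }

    f∤1 : ∀ {k} → 0 < k → HasSize f k → f ∤ 1#
    f∤1 0<k fᵏ f∣1 = ℕ.<⇒≢ 0<k (≡.sym (unit-size f∣1 fᵏ))

    productOfAtMost : ∀ {k} → 0 < k → HasSize f k → ProductOfAtMost k f
    productOfAtMost 0<k fᵏ =
      factorization-exists (<-wellFounded _) ∣-refl (f∤1 0<k fᵏ) fᵏ ,
      λ m F → length≤size (factors F) (p∤1 ∘ irreducible F) ∣-refl (product≈ F) fᵏ

    size-1⇒irreducible : HasSize f 1 → Irreducible f
    size-1⇒irreducible f¹ = mkIrred (f∤1 (s≤s z≤n) f¹) split
      where
      split : ∀ {x y} → f ≈ x * y → x ∣ 1# ⊎ y ∣ 1#
      split {x} {y} f≈xy with em {x ∣ 1#} | em {y ∣ 1#}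
      ... | yes x∣1 | _       = inj₁ x∣1
      ... | no _    | yes y∣1 = inj₂ y∣1
      ... | no x∤1  | no y∤1  = contradiction
        -- Two non-unit factors would give 2 ≤ 1.
        (length≤size (x Vector.∷ y Vector.∷ Vector.[]) (λ { zero → x∤1 ; (suc zero) → y∤1 })
          ∣-refl (trans (*-congˡ (*-identityʳ y)) (sym f≈xy)) f¹)
        λ { (s≤s ()) }

-- Degree in y minus dominant index, as a size on the divisors of `f`.

module DivisorSize {c ℓ} (R : CommutativeRing c ℓ) (noZeroDivisors : NoZeroDivisors R)
                   (dec : (P : Set ℓ) → Dec P) where
  private
    module R[x]     = PolynomialRing R
    module R[x]′    = CommutativeRing R[x].commutativeRing
    module R[x][y]  = PolynomialRing R[x].commutativeRing
    module R[x][y]′ = CommutativeRing R[x][y].commutativeRing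
    module ∣[x]     = SemiringDivisibility R[x]′.semiring
    module DegX     = DegreeProperties R
    module DegY     = DegreeProperties R[x].commutativeRing
  open SemiringDivisibility R[x][y]′.semiring using (_∣_; _∤_; _,_; ∣-respˡ; ∣-trans)

  noZeroDivisors[x] : NoZeroDivisors R[x].commutativeRing
  noZeroDivisors[x] = DegX.noZeroDivisors-poly (λ _ _ → dec _) noZeroDivisors

  -- Constant terms multiply. This makes `dominant-exists` applicable to every divisor of `f`.
  divisor-coeff₀≉0 : ∀ {f g} → R[x][y].coeff f 0 R[x]′.≉ R[x]′.0# → g ∣ f →
                     R[x][y].coeff g 0 R[x]′.≉ R[x]′.0#
  divisor-coeff₀≉0 {f} {g} f₀≉0 (h , hg≈f) g₀≈0 = f₀≉0
    (R[x]′.trans (R[x]′.sym (R[x][y].coeff-≈ hg≈f 0))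
    (R[x]′.trans (R[x][y].coeff-* h g 0)
    (R[x]′.trans (R[x]′.*-congˡ {R[x][y].coeff h 0} g₀≈0) (R[x]′.zeroʳ (R[x][y].coeff h 0)))))

  -- The size is deg_y g - J(g), written additively to avoid truncated subtraction.
  HasSize : ℕ → R[x][y].Poly → ℕ → Set ℓ
  HasSize s g k = ∃[ i ] ∃[ w ] Dominant g i w × DegY.HasDegree g (i ℕ.+ k)
    where open Dominance R noZeroDivisors dec s using (Dominant)

  module _ {f n s} (f-degree : DegY.HasDegree f n)
           (lead-degree : DegX.HasDegree (R[x][y].coeff f n) s)
           (f₀≉0 : R[x][y].coeff f 0 R[x]′.≉ R[x]′.0#)
           (isPrimitive : ∀ b → R[x][y].const b ∣ f → b ∣[x].∣ R[x]′.1#) where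
    open Dominance R noZeroDivisors dec s using
      (Dominant; dominant-resp-≈; dominant-unique; dominant-*; dominant-exists)

    private
      nonzero : ∀ {g i} → R[x][y].coeff g i R[x]′.≉ R[x]′.0# → g R[x][y]′.≉ R[x][y]′.0#
      nonzero gᵢ≉0 g≈0 = gᵢ≉0 (R[x][y].coeff-≈ g≈0 _)

      size-homo : ∀ {g h k l} → HasSize s g k → HasSize s h l → HasSize s (g R[x][y].*ₚ h) (k ℕ.+ l)
      size-homo {g} {h} {k} {l} (i , v , gⁱ , gᵐ) (j , w , hʲ , hⁿ) =
        i ℕ.+ j , v ℕ.+ w , dominant-* gⁱ hʲ ,
        ≡.subst (DegY.HasDegree (g R[x][y].*ₚ h)) (+-interchange i k j l)
          (DegY.degree-* noZeroDivisors[x] gᵐ hⁿ)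
        where
        open CommutativeSemigroupProperties ℕ.+-commutativeSemigroup
          renaming (interchange to +-interchange)

      size-exists : ∀ {g} → g ∣ f → ∃[ k ] HasSize s g k
      size-exists {g} g∣f =
        let g₀≉0       = divisor-coeff₀≉0 f₀≉0 g∣f
            i , w , gⁱ = dominant-exists g₀≉0
            m , gᵐ     = DegY.degree-exists (λ _ _ → dec _) (nonzero {g} g₀≉0)
            gᵢ≉0       = λ gᵢ≈0 → Dominant.attained gⁱ (R[x].coeff-≈ gᵢ≈0 _)
            -- The dominant coefficient is nonzero, so its index cannot exceed the degree in y.
            i≤m        = ℕ.≮⇒≥ (gᵢ≉0 ∘ DegY.vanishes (DegY.HasDegree.bounded gᵐ) i)
        in  m ∸ i , i , w , gⁱ , ≡.subst (DegY.HasDegree g) (≡.sym (ℕ.m+[n∸m]≡n i≤m)) gᵐ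

      -- Such a `g` equals its constant term `b`, a factor of `f` in the coefficient ring, which is
      -- a unit by `isPrimitive`.
      constant-divisor∣1 : ∀ {g} → g ∣ f → DegY.HasDegree g 0 → g ∣ R[x][y]′.1#
      constant-divisor∣1 {g} g∣f g⁰ =
        let q , qb≈1 = isPrimitive b (∣-respˡ g≈b g∣f)
        in  R[x][y].const q , R[x][y].mk≈ λ where
              zero    → R[x]′.trans (R[x][y].coeff-* (R[x][y].const q) g 0) qb≈1
              (suc i) → DegY.vanishes
                (DegY.below-* (DegY.below-length (R[x][y].const q)) (DegY.HasDegree.bounded g⁰))
                (suc i) (s≤s z≤n)
        where
        b = R[x][y].coeff g 0

        g≈b : g R[x][y].≈ₚ R[x][y].const b
        g≈b = R[x][y].mk≈ λ where
          zero    → R[x]′.refl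
          (suc i) → DegY.vanishes (DegY.HasDegree.bounded g⁰) (suc i) (s≤s z≤n)

      -- Otherwise the leading coefficient of g has degree w + (suc i) s > s,
      -- while it divides that of f.
      dominant-index≢degree : ∀ {g i w} → g ∣ f → Dominant g (suc i) w →
                              ¬ DegY.HasDegree g (suc i)
      dominant-index≢degree {g} {i} {w} g∣f@(h , hg≈f) gᵈ gᵐ =
        let e , hᵉ = DegY.degree-exists (λ _ _ → dec _) h≉0
            module H = DegY.HasDegree hᵉ
            e+m≡n  = DegY.degree-unique
              (DegY.degree-resp-≈ hg≈f (DegY.degree-* noZeroDivisors[x] hᵉ gᵐ)) f-degree
            d , lᵈ = DegX.degree-exists (λ _ _ → dec _) H.leading
            lead   = R[x]′.trans
                     (R[x]′.sym (DegY.coeff-*-top H.bounded (DegY.HasDegree.bounded gᵐ)))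
                     (R[x]′.trans (R[x][y].coeff-≈ hg≈f _)
                       (R[x]′.reflexive (≡.cong (R[x][y].coeff f) e+m≡n)))
            d+w+≡s = DegX.degree-unique (DegX.degree-resp-≈ lead
              (DegX.degree-* noZeroDivisors lᵈ (Dominant.hasDegree gᵈ))) lead-degree
        in  ℕ.<⇒≢ (ℕ.<-≤-trans (ℕ.m<n+m s 0<w)
              (ℕ.≤-trans (ℕ.+-monoʳ-≤ w (ℕ.m≤m+n s (i ℕ.* s))) (ℕ.m≤n+m _ d)))
              (≡.sym d+w+≡s)
        where
        h≉0 : h R[x][y]′.≉ R[x][y]′.0#
        h≉0 h≈0 = f₀≉0 (R[x][y].coeff-≈ (R[x][y]′.trans (R[x][y]′.sym hg≈f)
          (R[x][y]′.trans (R[x][y]′.*-congʳ h≈0) (R[x][y]′.zeroˡ g))) 0)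

        0<w : 0 < w
        -- For w = 0 the strict bound at index 0 < suc i would make the constant term of `g` zero.
        0<w = ℕ.n≢0⇒n>0 λ where
          ≡.refl → divisor-coeff₀≉0 f₀≉0 g∣f (DegX.below-0⇒≈0 (Dominant.strict gᵈ 0 (s≤s z≤n)))

      -- Size 0 means that the dominant index equals the degree in y. If both are 0, then `g` is a
      -- unit; if both are positive, the leading coefficient has too large a degree.
      size-positive : ∀ {g k} → g ∣ f → g ∤ R[x][y]′.1# → HasSize s g k → 0 < k
      size-positive {k = suc _} _   _   _                      = s≤s z≤n
      size-positive {k = zero}  g∣f g∤1 (zero  , _ , _  , g⁰) =
        contradiction (constant-divisor∣1 g∣f g⁰) g∤1
      size-positive {k = zero}  g∣f _   (suc i , _ , gᵈ , gᵐ) =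
        contradiction (≡.subst (DegY.HasDegree _) (ℕ.+-identityʳ (suc i)) gᵐ)
                      (dominant-index≢degree g∣f gᵈ)

    isSizeOfDivisors : FactorCount.IsSizeOfDivisors R[x][y]′.commutativeSemiring f (HasSize s)
    isSizeOfDivisors = record
      { resp-≈   = λ g≈h (i , w , gⁱ , gᵐ) →
          i , w , dominant-resp-≈ g≈h gⁱ , DegY.degree-resp-≈ g≈h gᵐ
      ; unique   = λ { {g} {k} {l} (i , _ , gⁱ , gᵏ) (j , _ , gʲ , gˡ) →
          ℕ.+-cancelˡ-≡ i k l (≡.trans (DegY.degree-unique gᵏ gˡ)
            (≡.cong (ℕ._+ l) (dominant-unique gʲ gⁱ))) }
      ; exists   = size-exists
      ; homo     = size-homo
      ; positive = size-positive
      }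

-- From the hypothesis on degrees with -∞ to inequalities of natural numbers.

max-≢-bound : ∀ {m} {j : Fin m} {v d} → d >₋ max-≢ j v → ∀ {i} → i ≢ j → d >₋ v i
max-≢-bound {j = j} {v} d>max {i} i≢j = <₋-transʳ ℤ.≤-<-trans
  (All.lookup (Extrema.xs≤max ℤ₋-totalOrder nothing _)
    (∈-map⁺ v (∈-filter⁺ (λ i → ¬? (i Fin.≟ j)) (∈-allFin i) i≢j)))
  d>max

-- Nothing lies below -∞. Applied to the hypothesis this gives aⱼ a degree.
>₋-finite : ∀ {x : ℕ ₋} {e} → Maybe.map +_ x >₋ e → ∃[ d ] x ≡ just d
>₋-finite {just d} _ = d , ≡.refl

-- Adding i s to both sides removes the difference j - i, so the inequality can be read in the
-- natural numbers.
>₋⇒< : ∀ {x y z d e s i j} → x ≡ just d → y ≡ just e → z ≡ just s →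
       Maybe.map +_ x >₋ Maybe.map +_ y +₋ (+ j - + i) ·₋ Maybe.map +_ z →
       e ℕ.+ j ℕ.* s < d ℕ.+ i ℕ.* s
>₋⇒< {d = d} {e} {s} {i} {j} ≡.refl ≡.refl ≡.refl x>y = ℤ.drop‿+<+
  (≡.subst₂ ℤ._<_ (≡.trans (cancel (+ e) (+ i) (+ j) (+ s)) (embed e j)) (embed d i)
    (ℤ.+-monoˡ-< (+ i ℤ.* + s) ([<]-injective x>y)))
  where
  cancel : ∀ e i j s → e ℤ.+ (j - i) ℤ.* s ℤ.+ i ℤ.* s ≡ e ℤ.+ j ℤ.* s
  cancel = ℤSolver.solve-∀

  embed : ∀ d i → + d ℤ.+ + i ℤ.* + s ≡ + (d ℕ.+ i ℕ.* s)
  embed d i = ≡.trans (≡.cong (ℤ._+_ (+ d)) (≡.sym (ℤ.pos-* i s))) (≡.sym (ℤ.pos-+ d (i ℕ.* s)))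

-- Coefficients of tabulated polynomials; fields have no zero divisors.

module _ {c ℓ} (R : CommutativeRing c ℓ) where
  open CommutativeRing R using (Carrier; 0#)
  open PolynomialRing R

  coeff-tabulate : ∀ {m} (a : Fin m → Carrier) i → coeff (tabulate a) (toℕ i) ≡ a i
  coeff-tabulate a zero    = ≡.refl
  coeff-tabulate a (suc i) = coeff-tabulate (a ∘ suc) i

  -- Indices past the end of the list have coefficient `0#`, hence the extra premise on `0#`.
  coeff-tabulate-elim : ∀ {p} {P : ℕ → Carrier → Set p} {m} (a : Fin m → Carrier) →
                        (∀ i → P (toℕ i) (a i)) → (∀ k → P k 0#) →
                        ∀ k → P k (coeff (tabulate a) k)
  coeff-tabulate-elim {m = zero}  a Pa P0 k       = P0 k
  coeff-tabulate-elim {m = suc m} a Pa P0 zero    = Pa zero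
  coeff-tabulate-elim {P = P} {suc m} a Pa P0 (suc k) =
    coeff-tabulate-elim {P = P ∘ suc} (a ∘ suc) (Pa ∘ suc) (P0 ∘ suc) k

field-noZeroDivisors : ∀ {c ℓ} (K : Field c ℓ) → NoZeroDivisors (Field.commutativeRing K)
field-noZeroDivisors K {x} {y} x≉0 y≉0 xy≈0 =
  let z , xz≈1 = inverse x x≉0
  in  y≉0 (trans (sym (*-identityˡ y)) (trans (*-congʳ (sym xz≈1))
        (trans (xy∙z≈xz∙y x z y) (trans (*-congʳ xy≈0) (zeroˡ z)))))
  where
  open Field K
  open CommutativeSemigroupProperties *-commutativeSemigroup using (xy∙z≈xz∙y)

-- The given polynomial: its dominant term, its primitivity and its size n - j.

theorem7 : ∀ {c ℓ} (em : ExcludedMiddle (c ⊔ ℓ)) (K : Field c ℓ) →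
    let open Bivariate em K in
    (n : ℕ) → n ≥ 2 →
    (a : Fin (suc n) → K[x].Carrier) →
    let f = K[x][y].fromCoeffs a in
    a zero K[x].* a (fromℕ n) K[x].≉ K[x].0# →
    (∀ (g : K[x].Carrier) → K[x][y].const g K[x][y].∣ f → K[x].IsConstant g) →
    (j : Fin (suc n)) → toℕ j ≤ n ∸ 1 →
    K[x].deg (a j) >₋
    max-≢ j (λ i → K[x].deg (a i) +₋ (+ toℕ j - + toℕ i) ·₋ K[x].deg (a (fromℕ n))) →
    K[x][y].ProductOfAtMost (n ∸ toℕ j) f ×
    (toℕ j ≡ n ∸ 1 → K[x][y].Irreducible f)
theorem7 {c} {ℓ} em K n n≥2 a a₀aₙ≉0 noFactor j j≤n-1 aⱼ-dominates =
  productOfAtMost em size (ℕ.m<n⇒0<n∸m j<n) f-size ,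
  -- For j = n - 1 the size is n - (n - 1) = 1.
  λ j≡n-1 → size-1⇒irreducible em size (≡.subst (HasSize s f)
    (≡.trans (≡.cong (n ∸_) j≡n-1) (ℕ.m∸[m∸n]≡n 1≤n)) f-size)
  where
  open Bivariate em K
  f = K[x][y].fromCoeffs a
  R = Field.commutativeRing K
  module P     = PolynomialRing R
  module P′    = CommutativeRing P.commutativeRing
  module Q     = PolynomialRing P.commutativeRing
  module Q′    = CommutativeRing Q.commutativeRing
  module DegX  = DegreeProperties R
  module DegY  = DegreeProperties P.commutativeRing
  module ∣[x]  = SemiringDivisibility P′.semiring

  1≤n : 1 ≤ n
  1≤n = ℕ.≤-trans (s≤s z≤n) n≥2

  j<n : toℕ j < n
  j<n = ℕ.≤-trans (s≤s j≤n-1) (ℕ.≤-reflexive (ℕ.m+[n∸m]≡n 1≤n))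

  dec : (X : Set ℓ) → Dec X
  dec X = map′ lower lift (em {Lift c X})

  open FactorCount Q′.commutativeSemiring
  open DivisorSize R (field-noZeroDivisors K) dec

  a₀≉0 : a zero K[x].≉ K[x].0#
  a₀≉0 a₀≈0 = a₀aₙ≉0 (P′.trans (P′.*-congʳ {a (fromℕ n)} a₀≈0) (P′.zeroˡ (a (fromℕ n))))

  aₙ≉0 : a (fromℕ n) K[x].≉ K[x].0#
  aₙ≉0 aₙ≈0 = a₀aₙ≉0 (P′.trans (P′.*-congˡ {a zero} aₙ≈0) (P′.zeroʳ (a zero)))

  fₙ≡aₙ : Q.coeff f n ≡ a (fromℕ n)
  fₙ≡aₙ = ≡.trans (≡.cong (Q.coeff f) (≡.sym (Fin.toℕ-fromℕ n)))
                  (coeff-tabulate P.commutativeRing a (fromℕ n))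

  f-degree : DegY.HasDegree f n
  f-degree = record
    { bounded = ≡.subst (λ m → DegY.DegreeBelow m f) (List.length-tabulate a) (DegY.below-length f)
    ; leading = ≡.subst (K[x]._≉ K[x].0#) (≡.sym fₙ≡aₙ) aₙ≉0
    }

  degree-finite : ∀ {p} → p K[x].≉ K[x].0# → ∃[ d ] K[x].degree p ≡ just d
  degree-finite {p} p≉0 with K[x].degree p in eq
  ... | nothing = contradiction (DegX.degree-≡⊥ _≟_ p eq) p≉0
  ... | just d  = d , ≡.refl

  aₙ-degree : ∃[ s ] K[x].degree (a (fromℕ n)) ≡ just s
  aₙ-degree = degree-finite aₙ≉0

  s = proj₁ aₙ-degree

  aⱼ-degree : ∃[ d ] K[x].degree (a j) ≡ just d
  aⱼ-degree = >₋-finite aⱼ-dominates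

  d = proj₁ aⱼ-degree

  weight-< : ∀ {i e} → i ≢ j → K[x].degree (a i) ≡ just e →
             e ℕ.+ toℕ j ℕ.* s < d ℕ.+ toℕ i ℕ.* s
  weight-< {i} {e} i≢j aᵢ≡e = >₋⇒< {i = toℕ i} {j = toℕ j}
    (proj₂ aⱼ-degree) aᵢ≡e (proj₂ aₙ-degree) (max-≢-bound aⱼ-dominates i≢j)

  -- For j ≠ 0 the hypothesis at index 0 gives deg a₀ + j s < d, where a₀ ≠ 0. Hence the weight d -
  -- j s of the term of index j is a natural number.
  js≤d : toℕ j ℕ.* s ≤ d
  js≤d with j Fin.≟ zero
  ... | yes ≡.refl = z≤n
  ... | no  j≢0    =
    let e , a₀≡e = degree-finite a₀≉0
    in  ℕ.≤-trans (ℕ.m≤n+m _ e) (ℕ.≤-trans (ℕ.<⇒≤ (weight-< (j≢0 ∘ ≡.sym) a₀≡e))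
          (ℕ.≤-reflexive (ℕ.+-identityʳ d)))

  w = d ∸ toℕ j ℕ.* s

  d≡w+js : d ≡ w ℕ.+ toℕ j ℕ.* s
  d≡w+js = ≡.sym (ℕ.m∸n+n≡m js≤d)

  open Dominance R (field-noZeroDivisors K) dec s using (Dominant)

  strict : ∀ k → k ≢ toℕ j → DegX.DegreeBelow (w ℕ.+ k ℕ.* s) (Q.coeff f k)
  strict = coeff-tabulate-elim P.commutativeRing
    {P = λ k p → k ≢ toℕ j → DegX.DegreeBelow (w ℕ.+ k ℕ.* s) p} a below (λ _ _ → DegX.below-zero)
    where
    below : ∀ i → toℕ i ≢ toℕ j → DegX.DegreeBelow (w ℕ.+ toℕ i ℕ.* s) (a i)
    below i i≢j with K[x].degree (a i) in eq
    ... | nothing = DegX.below-resp-≈ (P′.sym (DegX.degree-≡⊥ _≟_ (a i) eq)) DegX.below-zero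
    -- Since d = w + j s, cancelling j s in `weight-<` leaves e < w + i s, where e = deg aᵢ.
    ... | just e  = DegX.below-mono
      (ℕ.+-cancelʳ-< (toℕ j ℕ.* s) e _ (≡.subst (e ℕ.+ toℕ j ℕ.* s <_)
        (≡.trans (≡.cong (ℕ._+ toℕ i ℕ.* s) d≡w+js) (xy∙z≈xz∙y w _ _))
        (weight-< (i≢j ∘ ≡.cong toℕ) eq)))
      (DegX.HasDegree.bounded (DegX.degree-≡[] _≟_ (a i) eq))
      where open CommutativeSemigroupProperties ℕ.+-commutativeSemigroup using (xy∙z≈xz∙y)

  fⱼ-degree : DegX.HasDegree (Q.coeff f (toℕ j)) (w ℕ.+ toℕ j ℕ.* s)
  fⱼ-degree = ≡.subst₂ DegX.HasDegree
    (≡.sym (coeff-tabulate P.commutativeRing a j)) d≡w+js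
    (DegX.degree-≡[] _≟_ (a j) (proj₂ aⱼ-degree))

  f-dominant : Dominant f (toℕ j) w
  f-dominant = record
    { strict   = λ k k<j → strict k (ℕ.<⇒≢ k<j)
    ; bounded  = bounded
    ; attained = DegX.HasDegree.leading fⱼ-degree
    }
    where
    bounded : ∀ k → DegX.DegreeBelow (suc (w ℕ.+ k ℕ.* s)) (Q.coeff f k)
    bounded k with k ℕ.≟ toℕ j
    ... | yes ≡.refl = DegX.HasDegree.bounded fⱼ-degree
    ... | no  k≢j    = DegX.below-mono (ℕ.n≤1+n _) (strict k k≢j)

  -- By hypothesis `b` is a constant α. It is nonzero because a₀ ≠ 0, so it has an inverse in the
  -- field.
  isPrimitive : ∀ b → Q.const b K[x][y].∣ f → b ∣[x].∣ P′.1#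
  isPrimitive b b∣f =
    let α , b≈α = noFactor b b∣f
        α≉0 = λ α≈0 → divisor-coeff₀≉0 {f} {Q.const b} a₀≉0 b∣f
          (P′.trans b≈α (P.mk≈ λ { zero → α≈0 ; (suc _) → refl }))
        β , αβ≈1 = inverse α α≉0
    in  P.const β ∣[x]., P′.trans (P′.*-congˡ {P.const β} b≈α) (P.mk≈ λ where
          zero    → trans (+-identityʳ _) (trans (*-comm β α) αβ≈1)
          (suc _) → refl)
    where open Field K hiding (zero)

  lead-degree : DegX.HasDegree (Q.coeff f n) s
  lead-degree = ≡.subst (λ p → DegX.HasDegree p s) (≡.sym fₙ≡aₙ)
    (DegX.degree-≡[] _≟_ (a (fromℕ n)) (proj₂ aₙ-degree))


  size : IsSizeOfDivisors f (HasSize s)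
  size = isSizeOfDivisors f-degree lead-degree a₀≉0 isPrimitive

  f-size : HasSize s f (n ∸ toℕ j)
  f-size = toℕ j , w , f-dominant ,
    ≡.subst (DegY.HasDegree f) (≡.sym (ℕ.m+[n∸m]≡n (ℕ.<⇒≤ j<n))) f-degree
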